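{- Let $C_{(\geq,\geq)}(x,y)$ be the bivariate generating function of the Catalan words avoiding the ordered pair of relations $(\geq,\geq)$, where $x$ marks the length and $y$ marks the number of descents. Then $$C_{(\geq,\geq)}(x,y)=\frac{1 - x - x^2 + x^2 y - \sqrt{(1 - x - x^2 (1 + y))^2 - 4 x^3 (1 + x) y}}{2 x^2 y}.$$
   Context: A Catalan word of length $n$ is a word $w=w_1w_2\cdots w_n$ over the non-negative integers with $w_1=0$ and $0\leq w_i\leq w_{i-1}+1$ for $i=2,\dots,n$; the empty word is the unique Catalan word of length $0$. For relations $X,Y\in\{<,>,\leq,\geq,=,\neq\}$, a word $w$ contains the pattern $(X,Y)$ if there is an index $i\geq 1$ (with $i+2\le n$) such that $w_i\,X\,w_{i+1}$ and $w_{i+1}\,Y\,w_{i+2}$; otherwise $w$ avoids $(X,Y)$. The number of descents $\mathrm{des}(w)$ is the number of indices $i$ with $w_i>w_{i+1}$. The bivariate generating function is $C_{(X,Y)}(x,y)=\sum_{w}x^{|w|}y^{\mathrm{des}(w)}$, the sum being over all Catalan words $w$ (of any length $|w|\geq 0$) avoiding $(X,Y)$. Identities are between formal power series in $x$ with coefficients polynomials in $y$ (after clearing denominators); the square root of a power series with constant term $1$ is the one with constant term $1$. -}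

module Defs where

open import Level using (0ℓ)
open import Algebra.Bundles.Raw using (RawRing)
import Algebra.Definitions.RawSemiring as RawSemiringDefs
open import Data.Bool.Base using (if_then_else_)
open import Data.Fin.Base using (toℕ)
import Data.Integer.Base as ℤ
open import Data.List.Base using (List; []; _∷_; length; map; foldr; filter; upTo; cartesianProductWith)
open import Data.List.Membership.Propositional using (_∈_)
open import Data.List.Membership.Propositional.Properties using (∈-cartesianProductWith⁺; ∈-cartesianProductWith⁻; ∈-upTo⁺; ∈-filter⁺; ∈-filter⁻)
open import Data.List.Properties using (∷-injective)
open import Data.List.Relation.Unary.All using (All; []; _∷_)
open import Data.List.Relation.Unary.Any using (here)
open import Data.List.Relation.Unary.Linked using (Linked; []; [-]; _∷_; linked?)
open import Data.List.Relation.Unary.Unique.Propositional using (Unique; []; _∷_)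
import Data.List.Relation.Unary.Unique.Propositional.Properties as Unique
open import Data.Nat.Base as ℕ using (ℕ; zero; suc; _∸_; s≤s)
open import Data.Nat.Properties using (_≟_; _≤?_; _>?_; _≥?_; ≤-refl; ≤-trans; ≤-reflexive; +-comm; +-suc; +-monoˡ-≤; m≤m+n)
open import Data.Product.Base using (_×_; _,_; proj₁; proj₂)
open import Data.Unit.Base using (⊤; tt)
open import Function.Bundles using (_⇔_; mk⇔)
open import Relation.Binary.Core using (Rel)
open import Relation.Binary.Definitions using (Decidable)
open import Relation.Binary.PropositionalEquality using (_≡_; refl; sym; cong)
open import Relation.Nullary.Decidable using (yes; no; does; ¬?; _×-dec_)
open import Relation.Nullary.Negation using (¬_)
import Relation.Unary as U

------------------------------------------------------------------------
-- Polynomials and formal power series in one variable over a ring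

-- A polynomial is its list of coefficients, constant term first; trailing
-- zeros are permitted, so equality compares coefficients.
module Polynomial {c ℓ} (R : RawRing c ℓ) where
  open RawRing R

  Poly : Set c
  Poly = List Carrier

  coeff : Poly → ℕ → Carrier
  coeff []      _       = 0#
  coeff (a ∷ p) zero    = a
  coeff (a ∷ p) (suc k) = coeff p k

  add : Poly → Poly → Poly
  add []      q       = q
  add p       []      = p
  add (a ∷ p) (b ∷ q) = (a + b) ∷ add p q

  mul : Poly → Poly → Poly
  mul []      q = []
  mul (a ∷ p) q = add (map (a *_) q) (0# ∷ mul p q)

  rawRing : RawRing c ℓ
  rawRing = record
    { Carrier = Poly
    ; _≈_     = λ p q → ∀ k → coeff p k ≈ coeff q k
    ; _+_     = add
    ; _*_     = mul
    ; -_      = map (-_)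
    ; 0#      = []
    ; 1#      = 1# ∷ []
    }

  var : Poly
  var = 0# ∷ 1# ∷ []

-- A power series is its sequence of coefficients.
module PowerSeries {c ℓ} (R : RawRing c ℓ) where
  open RawRing R
  open RawSemiringDefs rawSemiring using (sum)

  Series : Set c
  Series = ℕ → Carrier

  const : Carrier → Series
  const a zero    = a
  const a (suc n) = 0#

  var : Series
  var 1 = 1#
  var _ = 0#

  rawRing : RawRing c ℓ
  rawRing = record
    { Carrier = Series
    ; _≈_     = λ f g → ∀ n → f n ≈ g n
    ; _+_     = λ f g n → f n + g n
    ; _*_     = λ f g n → sum {suc n} (λ i → f (toℕ i) * g (n ∸ toℕ i))
    ; -_      = λ f n → - f n
    ; 0#      = const 0#
    ; 1#      = const 1#
    }

ℤ[y] : RawRing 0ℓ 0ℓ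
ℤ[y] = Polynomial.rawRing ℤ.+-*-rawRing

ℤ[y]⟦x⟧ : RawRing 0ℓ 0ℓ
ℤ[y]⟦x⟧ = PowerSeries.rawRing ℤ[y]

module ℤ[y] where
  open RawRing ℤ[y] public
  open RawSemiringDefs rawSemiring public using (_^_)

open RawRing ℤ[y]⟦x⟧ public using (_≈_; _+_; _*_; -_; 0#; 1#) renaming (Carrier to Series)
open RawSemiringDefs (RawRing.rawSemiring ℤ[y]⟦x⟧) public using (_^_) renaming (_×_ to _·_)

infixl 6 _-_
_-_ : Series → Series → Series
f - g = f + (- g)

x : Series
x = PowerSeries.var ℤ[y]

y : Series
y = PowerSeries.const ℤ[y] (Polynomial.var ℤ.+-*-rawRing)

-- S is "the" square root of D with constant term 1.  There is at most one:
-- if S² ≈ T² then (S - T)(S + T) ≈ 0, and S + T has constant term 2 ≠ 0 in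
-- the integral domain ℤ[y]⟦x⟧.
record _IsSqrtOf_ (S D : Series) : Set where
  field
    square       : S * S ≈ D
    constantTerm : S 0 ℤ[y].≈ ℤ[y].1#

------------------------------------------------------------------------
-- Catalan words

Word : Set
Word = List ℕ

StartsWithZero : Word → Set
StartsWithZero []      = ⊤
StartsWithZero (a ∷ _) = a ≡ 0

IsCatalan : Word → Set
IsCatalan w = StartsWithZero w × Linked (λ a b → b ℕ.≤ suc a) w

data Contains (X Y : Rel ℕ 0ℓ) : Word → Set where
  here  : ∀ {a b c w} → X a b → Y b c → Contains X Y (a ∷ b ∷ c ∷ w)
  there : ∀ {a w} → Contains X Y w → Contains X Y (a ∷ w)

Avoids : (X Y : Rel ℕ 0ℓ) → Word → Set
Avoids X Y w = ¬ Contains X Y w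

des : Word → ℕ
des []          = 0
des (a ∷ [])    = 0
des (a ∷ b ∷ w) = (if does (a >? b) then 1 else 0) ℕ.+ des (b ∷ w)

isCatalan? : U.Decidable IsCatalan
isCatalan? w = startsWithZero? w ×-dec linked? (λ a b → b ≤? suc a) w
  where
  startsWithZero? : U.Decidable StartsWithZero
  startsWithZero? []      = yes tt
  startsWithZero? (a ∷ _) = a ≟ 0

module _ {X Y : Rel ℕ 0ℓ} (X? : Decidable X) (Y? : Decidable Y) where

  contains? : U.Decidable (Contains X Y)
  contains? []       = no λ ()
  contains? (a ∷ []) = no λ { (there ()) }
  contains? (a ∷ b ∷ []) = no λ { (there (there ())) }
  contains? (a ∷ b ∷ c ∷ w) with X? a b ×-dec Y? b c | contains? (b ∷ c ∷ w)
  ... | yes (p , q) | _     = yes (here p q)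
  ... | no  _       | yes r = yes (there r)
  ... | no  ¬pq     | no ¬r = no λ { (here p q) → ¬pq (p , q) ; (there r) → ¬r r }

  avoids? : U.Decidable (Avoids X Y)
  avoids? w = ¬? (contains? w)

-- All words of length n over the alphabet {0, …, m - 1}.
wordsOver : (m n : ℕ) → List Word
wordsOver m zero    = [] ∷ []
wordsOver m (suc n) = cartesianProductWith _∷_ (upTo m) (wordsOver m n)

-- The letters of a Catalan word of length n are smaller than n, so the search
-- space loses nothing; see ∈-catalanAvoiding and catalanAvoiding-unique.
catalanAvoiding : {X Y : Rel ℕ 0ℓ} → Decidable X → Decidable Y → ℕ → List Word
catalanAvoiding X? Y? n = filter (λ w → isCatalan? w ×-dec avoids? X? Y? w) (wordsOver n n)

-- The generating function Σ_w x^|w| y^(des w), over the Catalan words w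
-- avoiding (X , Y).
C : {X Y : Rel ℕ 0ℓ} → Decidable X → Decidable Y → Series
C X? Y? n = foldr ℤ[y]._+_ ℤ[y].0# (map (λ w → Polynomial.var ℤ.+-*-rawRing ℤ[y].^ des w) (catalanAvoiding X? Y? n))

------------------------------------------------------------------------
-- catalanAvoiding enumerates exactly the intended words, without repetition

private
  wordsOver-length : ∀ m n {w} → w ∈ wordsOver m n → length w ≡ n
  wordsOver-length m zero    (here refl) = refl
  wordsOver-length m (suc n) w∈ with ∈-cartesianProductWith⁻ _∷_ (upTo m) (wordsOver m n) w∈
  ... | _ , _ , _ , v∈ , refl = cong suc (wordsOver-length m n v∈)

  ∈-wordsOver : ∀ m w → All (ℕ._< m) w → w ∈ wordsOver m (length w)
  ∈-wordsOver m []      []       = here refl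
  ∈-wordsOver m (a ∷ w) (p ∷ ps) = ∈-cartesianProductWith⁺ _∷_ (∈-upTo⁺ p) (∈-wordsOver m w ps)

  wordsOver-unique : ∀ m n → Unique (wordsOver m n)
  wordsOver-unique m zero    = [] ∷ []
  wordsOver-unique m (suc n) =
    Unique.cartesianProductWith⁺ _∷_ ∷-injective (Unique.upTo⁺ m) (wordsOver-unique m n)

  linked-bound : ∀ {m} a w → Linked (λ a b → b ℕ.≤ suc a) (a ∷ w) →
                 a ℕ.+ length (a ∷ w) ℕ.≤ m → All (ℕ._< m) (a ∷ w)
  linked-bound a []      [-]     h = ≤-trans (≤-reflexive (+-comm 1 a)) h ∷ []
  linked-bound {m} a (b ∷ w) (p ∷ l) h =
    ≤-trans (s≤s (m≤m+n a _)) h′ ∷ linked-bound b w l (≤-trans (+-monoˡ-≤ (length (b ∷ w)) p) h′)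
    where
    h′ : suc a ℕ.+ length (b ∷ w) ℕ.≤ m
    h′ = ≤-trans (≤-reflexive (sym (+-suc a _))) h

  catalan-bound : ∀ w → IsCatalan w → All (ℕ._< length w) w
  catalan-bound []      _          = []
  catalan-bound (_ ∷ w) (refl , l) = linked-bound 0 w l ≤-refl

module _ {X Y : Rel ℕ 0ℓ} (X? : Decidable X) (Y? : Decidable Y) where

  ∈-catalanAvoiding : ∀ n w → w ∈ catalanAvoiding X? Y? n ⇔ (length w ≡ n × IsCatalan w × Avoids X Y w)
  ∈-catalanAvoiding n w = mk⇔ to from
    where
    P? : U.Decidable (λ w → IsCatalan w × Avoids X Y w)
    P? w = isCatalan? w ×-dec avoids? X? Y? w
    to : w ∈ catalanAvoiding X? Y? n → length w ≡ n × IsCatalan w × Avoids X Y w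
    to w∈ with ∈-filter⁻ P? {xs = wordsOver n n} w∈
    ... | w∈′ , p = wordsOver-length n n w∈′ , p
    from : length w ≡ n × IsCatalan w × Avoids X Y w → w ∈ catalanAvoiding X? Y? n
    from (refl , p) = ∈-filter⁺ P? (∈-wordsOver (length w) w (catalan-bound w (proj₁ p))) p

  catalanAvoiding-unique : ∀ n → Unique (catalanAvoiding X? Y? n)
  catalanAvoiding-unique n = Unique.filter⁺ (λ w → isCatalan? w ×-dec avoids? X? Y? w) (wordsOver-unique n n)

-- Let H count the words v for which 0v is an avoiding Catalan word that does not
-- begin with a weak descent.  A nonempty avoiding word is 0v or 00v for such a v,
-- so C = 1 + (x + x²) H.  Such a v either has no letter 0, and is then u + 1 for
-- an avoiding word u, or it is p 0 v′ with p free of 0.  Since p is followed by a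
-- descent, its last letter exceeds the one before it by exactly 1, so p arises
-- from u + 1 (preceded by 0) by appending a forced letter, while v′ is again
-- counted by H: thus H = C + x² y C H.  Eliminating H gives
-- C + x² y C = 1 + (x + x²) C + x² y C², and the claim follows by
-- completing the square.

module Submission where

open import Algebra.Bundles using (CommutativeRing; Semiring)
open import Algebra.Bundles.Raw using (RawRing)
import Algebra.Definitions.RawSemiring as RawSemiringDefinitions
import Algebra.Morphism.RingMonomorphism as RingMonomorphism
open import Algebra.Morphism.Structures using (IsRingMonomorphism)
import Algebra.Properties.AbelianGroup as AbelianGroupProperties
import Algebra.Properties.CommutativeSemigroup as CommutativeSemigroupProperties
import Algebra.Properties.Monoid.Sum as MonoidSum
import Algebra.Properties.Ring as RingProperties
import Algebra.Properties.Semiring.Exp as Exp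
import Algebra.Solver.Ring.NaturalCoefficients.Default as RingSolver
open import Data.Bool.Base using (if_then_else_)
open import Data.Empty using (⊥-elim)
open import Data.Fin.Base using (Fin; zero; suc; toℕ; fromℕ<)
open import Data.Fin.Properties using (toℕ-fromℕ<; toℕ-injective; toℕ≤pred[n])
import Data.Integer.Base as ℤ
import Data.Integer.Properties as ℤ
open import Data.List.Base using (List; []; _∷_; _++_; map; foldr; length; drop; filter; concat; tabulate; cartesianProductWith)
open import Data.List.Membership.Propositional using (_∈_)
open import Data.List.Membership.Propositional.Properties
open import Data.List.Membership.Propositional.Properties.WithK using (unique∧set⇒bag)
open import Data.List.Properties using (∷-injective; ∷-injectiveʳ; map-injective; map-∘; map-id-local; length-map; length-++)
open import Data.List.Relation.Binary.BagAndSetEquality using (∼bag⇒↭)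
open import Data.List.Relation.Binary.Disjoint.Propositional using (Disjoint)
open import Data.List.Relation.Binary.Permutation.Propositional as Perm using (_↭_)
import Data.List.Relation.Unary.All as All
import Data.List.Relation.Unary.All.Properties as All
import Data.List.Relation.Unary.AllPairs.Properties as AllPairs
open import Data.List.Relation.Unary.Any using (here; there)
open import Data.List.Relation.Unary.Linked using (Linked; []; [-]; _∷_)
open import Data.List.Relation.Unary.Unique.Propositional using (Unique; []; _∷_)
import Data.List.Relation.Unary.Unique.Propositional.Properties as Unique
open import Data.Nat.Base as ℕ using (ℕ; zero; suc; _∸_; _≤_; _<_; _≥_; z≤n; s≤s; z<s)
open import Data.Nat.Properties using (_≥?_)
open import Data.Product using (∃-syntax; _×_; _,_; proj₁)
open import Data.Sum.Base using (_⊎_; inj₁; inj₂)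
open import Data.Unit.Base using (⊤; tt)
open import Function.Base using (_∘_)
open import Function.Bundles using (mk⇔; Equivalence)
open import Level using (0ℓ)
open import Relation.Binary.PropositionalEquality as ≡ using (_≡_)
import Relation.Binary.Reasoning.Setoid as SetoidReasoning
open import Relation.Nullary.Decidable using (does; dec-false; yes; no)
import Relation.Unary as U
open import Defs using (module Polynomial; module PowerSeries; Word; StartsWithZero; Avoids; here; there; des; catalanAvoiding; ∈-catalanAvoiding; catalanAvoiding-unique)

-- The commutative ring of formal power series

module PowerSeriesRing {c ℓ} (R : CommutativeRing c ℓ) where
  open CommutativeRing R
  open PowerSeries rawRing using (Series; const) renaming (rawRing to rawSeriesRing)
  open RawRing rawSeriesRing using ()
    renaming (_≈_ to _≋_; _+_ to _⊕_; _*_ to _⊛_; -_ to ⊖_; 0# to 𝟘; 1# to 𝟙)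
  open CommutativeSemigroupProperties +-commutativeSemigroup using (interchange; x∙yz≈y∙xz)
  open SetoidReasoning setoid

  const-0# : ∀ n → const 0# n ≈ 0#
  const-0# zero    = refl
  const-0# (suc n) = refl

  -- By definition `(f ⊛ g) (suc n)` unfolds to `f 0 * g (suc n) + ((f ∘ suc) ⊛ g) n`. This
  -- recursion on the left factor drives the inductions below, with `f` generalised.
  ⊛-cong : ∀ {f f′ g g′} → f ≋ f′ → g ≋ g′ → f ⊛ g ≋ f′ ⊛ g′
  ⊛-cong f≋f′ g≋g′ zero    = +-congʳ (*-cong (f≋f′ 0) (g≋g′ 0))
  ⊛-cong f≋f′ g≋g′ (suc n) = +-cong (*-cong (f≋f′ 0) (g≋g′ (suc n))) (⊛-cong (f≋f′ ∘ suc) g≋g′ n)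

  ⊛-distribʳ : ∀ h f g → (f ⊕ g) ⊛ h ≋ (f ⊛ h) ⊕ (g ⊛ h)
  ⊛-distribʳ h f g zero    = begin
    (f 0 + g 0) * h 0 + 0#            ≈⟨ +-cong (distribʳ _ _ _) (sym (+-identityˡ 0#)) ⟩
    f 0 * h 0 + g 0 * h 0 + (0# + 0#) ≈⟨ interchange _ _ _ _ ⟩
    f 0 * h 0 + 0# + (g 0 * h 0 + 0#) ∎
  ⊛-distribʳ h f g (suc n) = begin
    (f 0 + g 0) * h (suc n) + (((f ∘ suc) ⊕ (g ∘ suc)) ⊛ h) n
      ≈⟨ +-cong (distribʳ _ _ _) (⊛-distribʳ h (f ∘ suc) (g ∘ suc) n) ⟩
    f 0 * h (suc n) + g 0 * h (suc n) + (((f ∘ suc) ⊛ h) n + ((g ∘ suc) ⊛ h) n)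
      ≈⟨ interchange _ _ _ _ ⟩
    f 0 * h (suc n) + ((f ∘ suc) ⊛ h) n + (g 0 * h (suc n) + ((g ∘ suc) ⊛ h) n) ∎

  scale-⊛ : ∀ a f g → (((a *_) ∘ f) ⊛ g) ≋ (a *_) ∘ (f ⊛ g)
  scale-⊛ a f g zero    = trans (+-cong (*-assoc _ _ _) (sym (zeroʳ a))) (sym (distribˡ _ _ _))
  scale-⊛ a f g (suc n) = trans (+-cong (*-assoc _ _ _) (scale-⊛ a (f ∘ suc) g n)) (sym (distribˡ _ _ _))

  ⊛-assoc : ∀ f g h → (f ⊛ g) ⊛ h ≋ f ⊛ (g ⊛ h)
  ⊛-assoc f g h zero    = +-congʳ (begin
    (f 0 * g 0 + 0#) * h 0   ≈⟨ *-congʳ (+-identityʳ _) ⟩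
    f 0 * g 0 * h 0          ≈⟨ *-assoc _ _ _ ⟩
    f 0 * (g 0 * h 0)        ≈⟨ *-congˡ (+-identityʳ _) ⟨
    f 0 * (g 0 * h 0 + 0#)   ∎)
  ⊛-assoc f g h (suc n) = begin
    -- The tail of `f ⊛ g` is by definition `((f 0 *_) ∘ g ∘ suc) ⊕ ((f ∘ suc) ⊛ g)`, so
    -- distributivity exposes the induction hypothesis for `f ∘ suc`.
    (f 0 * g 0 + 0#) * h (suc n) + (((((f 0 *_) ∘ g ∘ suc) ⊕ ((f ∘ suc) ⊛ g)) ⊛ h) n)
      ≈⟨ +-cong (trans (*-congʳ (+-identityʳ _)) (*-assoc _ _ _))
                (⊛-distribʳ h ((f 0 *_) ∘ g ∘ suc) ((f ∘ suc) ⊛ g) n) ⟩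
    f 0 * (g 0 * h (suc n)) + ((((f 0 *_) ∘ g ∘ suc) ⊛ h) n + (((f ∘ suc) ⊛ g) ⊛ h) n)
      ≈⟨ +-congˡ (+-cong (scale-⊛ (f 0) (g ∘ suc) h n) (⊛-assoc (f ∘ suc) g h n)) ⟩
    f 0 * (g 0 * h (suc n)) + (f 0 * ((g ∘ suc) ⊛ h) n + ((f ∘ suc) ⊛ (g ⊛ h)) n)
      ≈⟨ +-assoc _ _ _ ⟨
    f 0 * (g 0 * h (suc n)) + f 0 * ((g ∘ suc) ⊛ h) n + ((f ∘ suc) ⊛ (g ⊛ h)) n
      ≈⟨ +-congʳ (distribˡ _ _ _) ⟨
    f 0 * (g ⊛ h) (suc n) + ((f ∘ suc) ⊛ (g ⊛ h)) n ∎

  -- The mirror image of the defining recursion, needed for commutativity.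
  ⊛-unfoldʳ : ∀ f g n → (f ⊛ g) (suc n) ≈ f (suc n) * g 0 + (f ⊛ (g ∘ suc)) n
  ⊛-unfoldʳ f g zero    = x∙yz≈y∙xz _ _ _
  ⊛-unfoldʳ f g (suc n) = trans (+-congˡ (⊛-unfoldʳ (f ∘ suc) g n)) (x∙yz≈y∙xz _ _ _)

  ⊛-comm : ∀ f g → f ⊛ g ≋ g ⊛ f
  ⊛-comm f g zero    = +-congʳ (*-comm _ _)
  ⊛-comm f g (suc n) = trans (+-cong (*-comm _ _) (⊛-comm (f ∘ suc) g n)) (sym (⊛-unfoldʳ g f n))

  -- Assuming only pointwise vanishing makes this applicable to the tail of `const a` and to
  -- `coeff []`.
  𝟘-⊛ : ∀ f g → (∀ n → f n ≈ 0#) → ∀ n → (f ⊛ g) n ≈ 0#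
  𝟘-⊛ f g f≈0 zero    = trans (+-identityʳ _) (trans (*-congʳ (f≈0 0)) (zeroˡ _))
  𝟘-⊛ f g f≈0 (suc n) = trans
    (+-cong (trans (*-congʳ (f≈0 0)) (zeroˡ _)) (𝟘-⊛ (f ∘ suc) g (f≈0 ∘ suc) n)) (+-identityʳ 0#)

  const-⊛ : ∀ a f → const a ⊛ f ≋ (a *_) ∘ f
  const-⊛ a f zero    = +-identityʳ _
  const-⊛ a f (suc n) = trans (+-congˡ (𝟘-⊛ _ f (λ _ → refl) n)) (+-identityʳ _)

  ⊛-identityˡ : ∀ f → 𝟙 ⊛ f ≋ f
  ⊛-identityˡ f n = trans (const-⊛ 1# f n) (*-identityˡ _)

  commutativeRing : CommutativeRing c ℓ
  commutativeRing = record
    { Carrier = Series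
    ; _≈_     = _≋_
    ; isCommutativeRing = record
      { isRing = record
        { +-isAbelianGroup = record
          { isGroup = record
            { isMonoid = record
              { isSemigroup = record
                { isMagma = record
                  { isEquivalence = record
                    { refl  = λ _ → refl
                    ; sym   = λ f≋g n → sym (f≋g n)
                    ; trans = λ f≋g g≋h n → trans (f≋g n) (g≋h n)
                    }
                  ; ∙-cong = λ f≋f′ g≋g′ n → +-cong (f≋f′ n) (g≋g′ n)
                  }
                ; assoc = λ f g h n → +-assoc (f n) (g n) (h n)
                }
              ; identity = (λ f n → trans (+-congʳ (const-0# n)) (+-identityˡ _))
                         , (λ f n → trans (+-congˡ (const-0# n)) (+-identityʳ _))
              }
            ; inverse = (λ f n → trans (-‿inverseˡ (f n)) (sym (const-0# n)))
                      , (λ f n → trans (-‿inverseʳ (f n)) (sym (const-0# n)))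
            ; ⁻¹-cong = λ f≋g n → -‿cong (f≋g n)
            }
          ; comm = λ f g n → +-comm (f n) (g n)
          }
        ; *-cong     = ⊛-cong
        ; *-assoc    = ⊛-assoc
        ; *-identity = ⊛-identityˡ , λ f n → trans (⊛-comm f 𝟙 n) (⊛-identityˡ f n)
        ; distrib    = (λ f g h n → trans (⊛-comm f (g ⊕ h) n)
                                      (trans (⊛-distribʳ f g h n) (+-cong (⊛-comm g f n) (⊛-comm h f n))))
                     , ⊛-distribʳ
        }
      ; *-comm = ⊛-comm
      }
    }

-- The commutative ring of polynomials, embedded in power series

module PolynomialRing {c ℓ} (R : CommutativeRing c ℓ) where
  open CommutativeRing R
  open Polynomial rawRing using (coeff; add; mul) renaming (rawRing to rawPolyRing)
  open PowerSeriesRing R using () renaming (commutativeRing to seriesRing)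
  private module S = CommutativeRing seriesRing
  open RingProperties ring using (-0#≈0#)

  coeff-add : ∀ p q k → coeff (add p q) k ≈ coeff p k + coeff q k
  coeff-add []      q       k       = sym (+-identityˡ _)
  coeff-add (a ∷ p) []      k       = sym (+-identityʳ _)
  coeff-add (a ∷ p) (b ∷ q) zero    = refl
  coeff-add (a ∷ p) (b ∷ q) (suc k) = coeff-add p q k

  coeff-scale : ∀ a p k → coeff (map (a *_) p) k ≈ a * coeff p k
  coeff-scale a []      k       = sym (zeroʳ a)
  coeff-scale a (b ∷ p) zero    = refl
  coeff-scale a (b ∷ p) (suc k) = coeff-scale a p k

  coeff-neg : ∀ p k → coeff (map -_ p) k ≈ - coeff p k
  coeff-neg []      k       = sym -0#≈0#
  coeff-neg (a ∷ p) zero    = refl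
  coeff-neg (a ∷ p) (suc k) = coeff-neg p k

  coeff-mul : ∀ p q → coeff (mul p q) S.≈ coeff p S.* coeff q
  coeff-mul []      q k       = sym (PowerSeriesRing.𝟘-⊛ R (coeff []) (coeff q) (λ _ → refl) k)
  coeff-mul (a ∷ p) q zero    = trans (coeff-add (map (a *_) q) _ 0) (+-congʳ (coeff-scale a q 0))
  coeff-mul (a ∷ p) q (suc k) =
    trans (coeff-add (map (a *_) q) _ (suc k)) (+-cong (coeff-scale a q (suc k)) (coeff-mul p q k))

  coeff-1# : coeff (1# ∷ []) S.≈ S.1#
  coeff-1# zero    = refl
  coeff-1# (suc k) = refl

  -- Equality of polynomials is by definition equality of coefficients, so injectivity is immediate
  -- and every ring law is pulled back from power series.
  coeff-isRingMonomorphism : IsRingMonomorphism rawPolyRing S.rawRing coeff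
  coeff-isRingMonomorphism = record
    { isRingHomomorphism = record
      { isSemiringHomomorphism = record
        { isNearSemiringHomomorphism = record
          { +-isMonoidHomomorphism = record
            { isMagmaHomomorphism = record
              { isRelHomomorphism = record { cong = λ p≈q → p≈q }
              ; homo = coeff-add
              }
            ; ε-homo = λ k → sym (PowerSeriesRing.const-0# R k)
            }
          ; *-homo = coeff-mul
          }
        ; 1#-homo = coeff-1#
        }
      ; -‿homo = coeff-neg
      }
    ; injective = λ p≈q → p≈q
    }

  commutativeRing : CommutativeRing c ℓ
  commutativeRing = record
    { isCommutativeRing = RingMonomorphism.isCommutativeRing coeff-isRingMonomorphism S.isCommutativeRing }

-- Avoiding Catalan words and their decomposition at the first return to 0

module AvoidingWords where
  open import Data.Nat.Properties
  open import Relation.Binary.PropositionalEquality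

  -- The Catalan step condition together with avoidance of (≥, ≥).
  data Chain : Word → Set where
    []      : Chain []
    [-]     : ∀ {a} → Chain (a ∷ [])
    [_]     : ∀ {a b} → b ≤ suc a → Chain (a ∷ b ∷ [])
    ⟨_,_⟩∷_ : ∀ {a b c w} → b ≤ suc a → a < b ⊎ b < c → Chain (b ∷ c ∷ w) → Chain (a ∷ b ∷ c ∷ w)

  chain⁺ : ∀ {w} → Linked (λ a b → b ≤ suc a) w → Avoids _≥_ _≥_ w → Chain w
  chain⁺ []            _     = []
  chain⁺ [-]           _     = [-]
  chain⁺ (p ∷ [-])     _     = [ p ]
  chain⁺ {a ∷ b ∷ c ∷ _} (p ∷ l@(_ ∷ _)) avoids = ⟨ p , rise ⟩∷ chain⁺ l (avoids ∘ there)
    where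
    rise : a < b ⊎ b < c
    rise with b ≤? a | c ≤? b
    ... | no b≰a  | _       = inj₁ (≰⇒> b≰a)
    ... | yes _   | no c≰b  = inj₂ (≰⇒> c≰b)
    ... | yes b≤a | yes c≤b = ⊥-elim (avoids (here b≤a c≤b))

  chain⇒linked : ∀ {w} → Chain w → Linked (λ a b → b ≤ suc a) w
  chain⇒linked []             = []
  chain⇒linked [-]            = [-]
  chain⇒linked [ p ]          = p ∷ [-]
  chain⇒linked (⟨ p , _ ⟩∷ r) = p ∷ chain⇒linked r

  chain⇒avoids : ∀ {w} → Chain w → Avoids _≥_ _≥_ w
  chain⇒avoids [-]                 (there ())
  chain⇒avoids [ _ ]               (there (there ()))
  chain⇒avoids (⟨ _ , inj₁ q ⟩∷ _) (here a≥b _) = <⇒≱ q a≥b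
  chain⇒avoids (⟨ _ , inj₂ q ⟩∷ _) (here _ b≥c) = <⇒≱ q b≥c
  chain⇒avoids (⟨ _ , _ ⟩∷ r)      (there c)    = chain⇒avoids r c

  map-suc⁺ : ∀ {w} → Chain w → Chain (map suc w)
  map-suc⁺ []                     = []
  map-suc⁺ [-]                    = [-]
  map-suc⁺ [ p ]                  = [ s≤s p ]
  map-suc⁺ (⟨ p , inj₁ q ⟩∷ r)    = ⟨ s≤s p , inj₁ (s≤s q) ⟩∷ map-suc⁺ r
  map-suc⁺ (⟨ p , inj₂ q ⟩∷ r)    = ⟨ s≤s p , inj₂ (s≤s q) ⟩∷ map-suc⁺ r

  map-suc⁻ : ∀ w → Chain (map suc w) → Chain w
  map-suc⁻ []              _                   = []
  map-suc⁻ (_ ∷ [])        _                   = [-]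
  map-suc⁻ (_ ∷ _ ∷ [])    [ s≤s p ]           = [ p ]
  map-suc⁻ (_ ∷ _ ∷ _ ∷ _) (⟨ s≤s p , inj₁ (s≤s q) ⟩∷ r) = ⟨ p , inj₁ q ⟩∷ map-suc⁻ _ r
  map-suc⁻ (_ ∷ _ ∷ _ ∷ _) (⟨ s≤s p , inj₂ (s≤s q) ⟩∷ r) = ⟨ p , inj₂ q ⟩∷ map-suc⁻ _ r

  -- A leading 0 of `u` is shifted to 1, so the new first step is a rise and creates no pair of weak
  -- descents.
  0∷map-suc⁺ : ∀ {u} → StartsWithZero u → Chain u → Chain (0 ∷ map suc u)
  0∷map-suc⁺ {[]}        _    _ = [-]
  0∷map-suc⁺ {_ ∷ []}    refl _ = [ ≤-refl ]
  0∷map-suc⁺ {_ ∷ _ ∷ _} refl r = ⟨ ≤-refl , inj₁ ≤-refl ⟩∷ map-suc⁺ r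

  -- The step bound after the leading 0 allows a first shifted letter of at most 1, so `u` starts
  -- with 0.
  0∷map-suc⁻ : ∀ u → Chain (0 ∷ map suc u) → StartsWithZero u × Chain u
  0∷map-suc⁻ []          _                    = tt , []
  0∷map-suc⁻ (_ ∷ [])    [ s≤s z≤n ]          = refl , [-]
  0∷map-suc⁻ (_ ∷ _ ∷ _) (⟨ s≤s z≤n , _ ⟩∷ r) = refl , map-suc⁻ _ r

  -- For a word `v` read after a letter 0: `0 ∷ v` does not begin with a weak descent.
  Rises : Word → Set
  Rises []      = ⊤
  Rises (b ∷ _) = 0 < b

  rises? : U.Decidable Rises
  rises? []      = yes tt
  rises? (b ∷ _) = 0 <? b

  0∷-chain : ∀ {b v} → Chain (0 ∷ v) → Rises v → Chain (b ∷ 0 ∷ v)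
  0∷-chain {v = []}    _ _   = [ z≤n ]
  0∷-chain {v = _ ∷ _} r 0<c = ⟨ z≤n , inj₂ 0<c ⟩∷ r

  0∷-chain⁻ : ∀ {b v} → Chain (b ∷ 0 ∷ v) → Chain (0 ∷ v) × Rises v
  0∷-chain⁻ [ _ ]                 = [-] , tt
  0∷-chain⁻ (⟨ _ , inj₂ 0<c ⟩∷ r) = r , 0<c

  -- a ∷ up a u is the word a ∷ u with its last letter plus one appended.
  up : ℕ → Word → Word
  up a []      = suc a ∷ []
  up a (b ∷ u) = b ∷ up b u

  length-up : ∀ a u → length (up a u) ≡ suc (length u)
  length-up a []      = refl
  length-up a (b ∷ u) = cong suc (length-up b u)

  -- The step into the appended letter is a rise, so the drop to 0 after it is harmless; the step
  -- out of that 0 must rise again.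
  up-chain⁺ : ∀ {a u v} → Chain (a ∷ u) → Chain (0 ∷ v) → Rises v → Chain (a ∷ up a u ++ 0 ∷ v)
  up-chain⁺ [-]            s t = ⟨ ≤-refl , inj₁ ≤-refl ⟩∷ 0∷-chain s t
  up-chain⁺ [ p ]          s t = ⟨ p , inj₂ ≤-refl ⟩∷ up-chain⁺ [-] s t
  up-chain⁺ (⟨ p , q ⟩∷ r) s t = ⟨ p , q ⟩∷ up-chain⁺ r s t

  -- The last letter of b ∷ p starts a weak descent to 0, so by avoidance the step
  -- into it is a rise, necessarily by 1.
  up-chain⁻ : ∀ a b p {v} → Chain (a ∷ b ∷ p ++ 0 ∷ v) →
              ∃[ u ] b ∷ p ≡ up a u × Chain (a ∷ u) × Chain (0 ∷ v) × Rises v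
  up-chain⁻ a b [] (⟨ b≤1+a , inj₁ a<b ⟩∷ r) =
    [] , cong (_∷ []) (≤-antisym b≤1+a a<b) , [-] , 0∷-chain⁻ r
  up-chain⁻ a b (c ∷ p) (⟨ b≤1+a , q ⟩∷ r) with up-chain⁻ b c p r
  -- The word `a ∷ b ∷ []` has no third letter, so `q` is dropped; in the next case `c` is `d` and
  -- `q` is kept.
  ... | []    , eq   , _ , s = b ∷ [] , cong (b ∷_) eq , [ b≤1+a ] , s
  ... | d ∷ u , refl , t , s = b ∷ d ∷ u , refl , ⟨ b≤1+a , q ⟩∷ t , s

  -- Deleting the last letter of `up a u` leaves `u`, so `u` inherits positive letters.
  up≡map-suc : ∀ a u p → up a u ≡ map suc p → ∃[ u′ ] u ≡ map suc u′
  up≡map-suc a []      p       _  = [] , refl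
  up≡map-suc a (b ∷ u) (c ∷ p) eq with ∷-injective eq
  ... | refl , eq′ with up≡map-suc b u p eq′
  ...   | u′ , refl = c ∷ u′ , refl

  -- The leading 0 of the Catalan word is left out here; it survives as the argument of `up`, which
  -- makes the appended letter 1 when `u` is empty.
  first-return : Word → Word → Word
  first-return u v = up 0 (map suc u) ++ 0 ∷ v

  -- All letters before the inserted 0 are positive, so the first 0 locates the cut in both words.
  first-return-injective : ∀ {u u′ v v′} → first-return u v ≡ first-return u′ v′ → u ≡ u′ × v ≡ v′
  first-return-injective = go 0 _ _
    where
    go : ∀ a u u′ {v v′} → up a (map suc u) ++ 0 ∷ v ≡ up a (map suc u′) ++ 0 ∷ v′ → u ≡ u′ × v ≡ v′
    go a []      []       refl = refl , refl
    -- The second letters clash, 0 against a successor; the case split lets `up` unfold far enough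
    -- to show it.
    go a []      (b ∷ []) ()
    go a []      (b ∷ _ ∷ _) ()
    go a (b ∷ []) []      ()
    go a (b ∷ _ ∷ _) []   ()
    go a (b ∷ u) (b′ ∷ u′) eq with ∷-injective eq
    ... | refl , eq′ with go (suc b) u u′ eq′
    ...   | refl , v≡v′ = refl , v≡v′

  length-first-return : ∀ u v → length (first-return u v) ≡ suc (suc (length u ℕ.+ length v))
  length-first-return u v = trans (length-++ (up 0 (map suc u)))
    (trans (cong (ℕ._+ suc (length v)) (trans (length-up 0 (map suc u)) (cong suc (length-map suc u))))
           (cong suc (+-suc _ _)))

  data SplitAtZero : Word → Set where
    no-zero    : ∀ p → SplitAtZero (map suc p)
    zero-after : ∀ p v → SplitAtZero (map suc p ++ 0 ∷ v)

  splitAtZero : ∀ w → SplitAtZero w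
  splitAtZero []          = no-zero []
  splitAtZero (zero ∷ w)  = zero-after [] w
  splitAtZero (suc a ∷ w) with splitAtZero w
  ... | no-zero p      = no-zero (a ∷ p)
  ... | zero-after p v = zero-after (a ∷ p) v

  first-return⁺ : ∀ {u v} → StartsWithZero u → Chain u → Chain (0 ∷ v) → Rises v →
                  Chain (0 ∷ first-return u v) × Rises (first-return u v)
  first-return⁺ {[]}    z r s t = up-chain⁺ [-] s t , z<s
  first-return⁺ {_ ∷ _} z r s t = up-chain⁺ (0∷map-suc⁺ z r) s t , z<s

  first-return⁻ : ∀ w → Chain (0 ∷ w) → Rises w →
                  (∃[ u ] w ≡ map suc u × StartsWithZero u × Chain u) ⊎
                  (∃[ u ] ∃[ v ] w ≡ first-return u v ×
                                 (StartsWithZero u × Chain u) × Chain (0 ∷ v) × Rises v)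
  first-return⁻ w r t with splitAtZero w
  ... | no-zero u          = inj₁ (u , refl , 0∷map-suc⁻ u r)
  -- The prefix is nonempty, since `Rises w` forbids `w` to begin with 0.
  ... | zero-after (a ∷ p) v with up-chain⁻ 0 (suc a) (map suc p) r
  ...   | u , eq , s , t′ with up≡map-suc 0 u (a ∷ p) (sym eq)
  ...     | u′ , refl = inj₂ (u′ , v , cong (_++ 0 ∷ v) eq , 0∷map-suc⁻ u′ s , t′)

  des-map-suc : ∀ u → des (map suc u) ≡ des u
  des-map-suc []          = refl
  des-map-suc (_ ∷ [])    = refl
  des-map-suc (a ∷ b ∷ u) = cong ((if does (a >? b) then 1 else 0) ℕ.+_) (des-map-suc (b ∷ u))

  des-0∷map-suc : ∀ u → des (0 ∷ map suc u) ≡ des u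
  des-0∷map-suc []      = refl
  des-0∷map-suc (a ∷ u) = des-map-suc (a ∷ u)

  -- The step into the appended letter is a rise and the drop from it to 0 is a descent, which the
  -- `suc` counts.
  des-up : ∀ a u v → des (a ∷ up a u ++ 0 ∷ v) ≡ des (a ∷ u) ℕ.+ suc (des (0 ∷ v))
  des-up a [] v = cong (λ b → (if b then 1 else 0) ℕ.+ suc (des (0 ∷ v)))
    (dec-false (a >? suc a) (λ a>1+a → <-asym a>1+a ≤-refl))
  des-up a (b ∷ u) v = trans (cong (d ℕ.+_) (des-up b u v)) (sym (+-assoc d _ _))
    where
    d : ℕ
    d = if does (a >? b) then 1 else 0

  des-first-return : ∀ u v → des (0 ∷ first-return u v) ≡ des u ℕ.+ suc (des (0 ∷ v))
  des-first-return u v = trans (des-up 0 (map suc u) v) (cong (ℕ._+ suc (des (0 ∷ v))) (des-0∷map-suc u))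

  -- Enumerations and the two recursive decompositions

  words : ℕ → List Word
  words = catalanAvoiding _≥?_ _≥?_

  words-unique : ∀ n → Unique (words n)
  words-unique = catalanAvoiding-unique _≥?_ _≥?_

  ∈-words⁺ : ∀ n {w} → length w ≡ n → StartsWithZero w → Chain w → w ∈ words n
  ∈-words⁺ n {w} l z r =
    Equivalence.from (∈-catalanAvoiding _≥?_ _≥?_ n w) (l , (z , chain⇒linked r) , chain⇒avoids r)

  ∈-words⁻ : ∀ n {w} → w ∈ words n → length w ≡ n × StartsWithZero w × Chain w
  ∈-words⁻ n {w} w∈ with Equivalence.to (∈-catalanAvoiding _≥?_ _≥?_ n w) w∈
  ... | l , (z , r) , a = l , z , chain⁺ r a

  -- The words v of length n such that 0 ∷ v is an avoiding Catalan word and does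
  -- not begin with a weak descent.
  tails : ℕ → List Word
  tails n = filter rises? (map (drop 1) (words (suc n)))

  -- On `words (suc n)` every word starts with 0, so prefixing 0 undoes `drop 1` and repetitions
  -- cannot arise.
  tails-unique : ∀ n → Unique (tails n)
  tails-unique n = Unique.filter⁺ rises? (Unique.map⁻ {f = 0 ∷_}
    (subst Unique (sym (trans (sym (map-∘ (words (suc n)))) (map-id-local (All.tabulate restore))))
      (words-unique (suc n))))
    where
    restore : ∀ {w} → w ∈ words (suc n) → 0 ∷ drop 1 w ≡ w
    restore {w} w∈ with w | ∈-words⁻ (suc n) w∈
    ... | []    | () , _
    ... | _ ∷ _ | _ , refl , _ = refl

  ∈-tails⁺ : ∀ n {v} → length v ≡ n → Chain (0 ∷ v) → Rises v → v ∈ tails n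
  ∈-tails⁺ n l r t = ∈-filter⁺ rises? (∈-map⁺ (drop 1) (∈-words⁺ (suc n) (cong suc l) refl r)) t

  ∈-tails⁻ : ∀ n {v} → v ∈ tails n → length v ≡ n × Chain (0 ∷ v) × Rises v
  ∈-tails⁻ n v∈ with ∈-filter⁻ rises? {xs = map (drop 1) (words (suc n))} v∈
  ... | v∈′ , t with ∈-map⁻ (drop 1) v∈′
  ...   | w , w∈ , refl with w | ∈-words⁻ (suc n) w∈
  ...     | []    | () , _
  ...     | _ ∷ _ | l , refl , r = suc-injective l , r , t

  -- Repetition-free lists with the same elements are equal as bags, so each decomposition reduces
  -- to two inclusions.
  unique∧sameElements⇒↭ : ∀ {a} {A : Set a} {xs ys : List A} → Unique xs → Unique ys →
                          (∀ {w} → w ∈ xs → w ∈ ys) → (∀ {w} → w ∈ ys → w ∈ xs) → xs ↭ ys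
  unique∧sameElements⇒↭ xs! ys! to from = ∼bag⇒↭ (unique∧set⇒bag xs! ys! (mk⇔ to from))

  -- Its words have length `suc n`, to match `words (suc n)`; hence none at index 0.
  doubled : ℕ → List Word
  doubled zero    = []
  doubled (suc n) = map (λ v → 0 ∷ 0 ∷ v) (tails n)

  -- In `0 ∷ 0 ∷ v` the initial weak descent forces `v` to rise. The two lists are disjoint because
  -- a tail never begins with 0.
  words-↭ : ∀ n → words (suc n) ↭ map (0 ∷_) (tails n) ++ doubled n
  words-↭ n = unique∧sameElements⇒↭ (words-unique (suc n))
    (Unique.++⁺ (Unique.map⁺ ∷-injectiveʳ (tails-unique n)) (doubled-unique n) (disjoint n))
    (λ w∈ → let l , z , r = ∈-words⁻ (suc n) w∈ in to n _ l z r) from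
    where
    doubled-unique : ∀ n → Unique (doubled n)
    doubled-unique zero    = []
    doubled-unique (suc n) = Unique.map⁺ (∷-injectiveʳ ∘ ∷-injectiveʳ) (tails-unique n)

    disjoint : ∀ n → Disjoint (map (0 ∷_) (tails n)) (doubled n)
    disjoint (suc n) (w∈ , w∈′) with ∈-map⁻ (0 ∷_) w∈ | ∈-map⁻ (λ v → 0 ∷ 0 ∷ v) w∈′
    ... | v , v∈ , refl | _ , _ , refl with ∈-tails⁻ (suc n) v∈
    ...   | _ , _ , ()

    to : ∀ n w → length w ≡ suc n → StartsWithZero w → Chain w → w ∈ map (0 ∷_) (tails n) ++ doubled n
    to n       (_ ∷ [])        l refl r = ∈-++⁺ˡ (∈-map⁺ (0 ∷_) (∈-tails⁺ n (suc-injective l) r tt))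
    to n       (_ ∷ suc _ ∷ _) l refl r = ∈-++⁺ˡ (∈-map⁺ (0 ∷_) (∈-tails⁺ n (suc-injective l) r z<s))
    to (suc n) (_ ∷ zero ∷ _)  l refl r with 0∷-chain⁻ r
    ... | s , t = ∈-++⁺ʳ (map (0 ∷_) (tails (suc n)))
                    (∈-map⁺ (λ v → 0 ∷ 0 ∷ v) (∈-tails⁺ n (suc-injective (suc-injective l)) s t))

    from-doubled : ∀ n {w} → w ∈ doubled n → w ∈ words (suc n)
    from-doubled (suc n) w∈ with ∈-map⁻ (λ v → 0 ∷ 0 ∷ v) w∈
    ... | v , v∈ , refl with ∈-tails⁻ n v∈
    ...   | l , r , t = ∈-words⁺ (suc (suc n)) (cong (2 ℕ.+_) l) refl (0∷-chain r t)

    from : ∀ {w} → w ∈ map (0 ∷_) (tails n) ++ doubled n → w ∈ words (suc n)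
    from w∈ with ∈-++⁻ (map (0 ∷_) (tails n)) w∈
    ... | inj₂ w∈′ = from-doubled n w∈′
    ... | inj₁ w∈′ with ∈-map⁻ (0 ∷_) w∈′
    ...   | v , v∈ , refl with ∈-tails⁻ n v∈
    ...     | l , r , _ = ∈-words⁺ (suc n) (cong suc l) refl r

  -- The index is the length of `u`, so summing over the blocks gives a Cauchy product coefficient
  -- term by term.
  returnsAt : ∀ n → Fin (suc n) → List Word
  returnsAt n i = cartesianProductWith first-return (words (toℕ i)) (tails (n ∸ toℕ i))

  -- The appended letter and the 0 add two to the lengths of `u` and `v`, so no such word is shorter
  -- than 2.
  returning : ℕ → List Word
  returning (suc (suc n)) = concat (tabulate (returnsAt n))
  returning _             = []

  ∈-returning⁺ : ∀ {n u v} → length (first-return u v) ≡ n →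
                 StartsWithZero u → Chain u → Chain (0 ∷ v) → Rises v →
                 first-return u v ∈ returning n
  ∈-returning⁺ {n} {u} {v} l z r s t with trans (sym (length-first-return u v)) l
  ... | refl = ∈-concat⁺′ {xss = tabulate (returnsAt m)}
      (∈-cartesianProductWith⁺ first-return (∈-words⁺ (toℕ i) (sym i≡) z r)
        (∈-tails⁺ (m ∸ toℕ i) (trans (sym (m+n∸m≡n (length u) _)) (cong (m ∸_) (sym i≡))) s t))
      (∈-tabulate⁺ {f = returnsAt m} i)
    where
    m : ℕ
    m = length u ℕ.+ length v
    i : Fin (suc m)
    i = fromℕ< (s≤s (m≤m+n (length u) (length v)))
    i≡ : toℕ i ≡ length u
    i≡ = toℕ-fromℕ< _

  ∈-returning⁻ : ∀ n {w} → w ∈ returning n →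
                 ∃[ u ] ∃[ v ] w ≡ first-return u v × length w ≡ n ×
                               (StartsWithZero u × Chain u) × Chain (0 ∷ v) × Rises v
  ∈-returning⁻ (suc (suc n)) w∈ with ∈-concat⁻′ (tabulate (returnsAt n)) w∈
  ... | _ , w∈′ , ws∈ with ∈-tabulate⁻ {f = returnsAt n} ws∈
  ...   | i , refl with ∈-cartesianProductWith⁻ first-return (words (toℕ i)) (tails (n ∸ toℕ i)) w∈′
  ...     | u , v , u∈ , v∈ , refl with ∈-words⁻ (toℕ i) u∈ | ∈-tails⁻ (n ∸ toℕ i) v∈
  ...       | lu , zr | lv , st =
    u , v , refl ,
    trans (length-first-return u v) (cong (2 ℕ.+_) (trans (cong₂ ℕ._+_ lu lv) (m+[n∸m]≡n (toℕ≤pred[n] i)))) ,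
    zr , st

  -- Within a block `first-return` is injective; across blocks equal words share `u`, whose length
  -- is the block index.
  returning-unique : ∀ n → Unique (returning n)
  returning-unique zero          = []
  returning-unique (suc zero)    = []
  returning-unique (suc (suc n)) = Unique.concat⁺
    (All.tabulate⁺ (λ i → Unique.cartesianProductWith⁺ first-return first-return-injective
      (words-unique (toℕ i)) (tails-unique (n ∸ toℕ i))))
    (AllPairs.tabulate⁺ disjoint)
    where
    disjoint : ∀ {i j} → i ≢ j → Disjoint (returnsAt n i) (returnsAt n j)
    disjoint {i} {j} i≢j (w∈ , w∈′)
      with ∈-cartesianProductWith⁻ first-return (words (toℕ i)) _ w∈
         | ∈-cartesianProductWith⁻ first-return (words (toℕ j)) _ w∈′
    ... | u , _ , u∈ , _ , eq | u′ , _ , u′∈ , _ , eq′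
      with first-return-injective {u} {u′} (trans (sym eq) eq′)
    ...   | refl , _ = i≢j (toℕ-injective (trans (sym (proj₁ (∈-words⁻ (toℕ i) u∈)))
                                         (proj₁ (∈-words⁻ (toℕ j) u′∈))))

  tails-↭ : ∀ n → tails n ↭ map (map suc) (words n) ++ returning n
  tails-↭ n = unique∧sameElements⇒↭ (tails-unique n)
    (Unique.++⁺ (Unique.map⁺ (map-injective suc-injective) (words-unique n)) (returning-unique n) disjoint) to from
    where
    disjoint : Disjoint (map (map suc) (words n)) (returning n)
    disjoint (w∈ , w∈′) with ∈-map⁻ (map suc) w∈ | ∈-returning⁻ n w∈′
    ... | p , _ , eq | u , v , eq′ , _
      -- A returning word contains the letter 0, a shifted word does not.
      with ∈-map⁻ suc (subst (0 ∈_) (trans (sym eq′) eq) (∈-++⁺ʳ (up 0 (map suc u)) (here refl)))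
    ...   | _ , _ , ()

    to : ∀ {w} → w ∈ tails n → w ∈ map (map suc) (words n) ++ returning n
    to {w} w∈ with ∈-tails⁻ n w∈
    ... | l , r , t with first-return⁻ w r t
    ...   | inj₁ (u , refl , z , s) = ∈-++⁺ˡ (∈-map⁺ (map suc) (∈-words⁺ n (trans (sym (length-map suc u)) l) z s))
    ...   | inj₂ (u , v , refl , (z , s) , s′ , t′) = ∈-++⁺ʳ (map (map suc) (words n)) (∈-returning⁺ {u = u} l z s s′ t′)

    rises-map-suc : ∀ u → Rises (map suc u)
    rises-map-suc []      = tt
    rises-map-suc (_ ∷ _) = z<s

    from : ∀ {w} → w ∈ map (map suc) (words n) ++ returning n → w ∈ tails n
    from w∈ with ∈-++⁻ (map (map suc) (words n)) w∈
    ... | inj₁ w∈′ with ∈-map⁻ (map suc) w∈′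
    ...   | u , u∈ , refl with ∈-words⁻ n u∈
    ...     | l , z , r = ∈-tails⁺ n (trans (length-map suc u) l) (0∷map-suc⁺ z r) (rises-map-suc u)
    from w∈ | inj₂ w∈′ with ∈-returning⁻ n w∈′
    ... | u , v , refl , l , (z , r) , s , t with first-return⁺ {u} z r s t
    ...   | r′ , t′ = ∈-tails⁺ n l r′ t′

-- Sums of weights over lists

module ListSum {c ℓ} (R : CommutativeRing c ℓ) where
  open CommutativeRing R hiding (zero)
  open CommutativeSemigroupProperties +-commutativeSemigroup using (x∙yz≈y∙xz)
  open RawSemiringDefinitions (Semiring.rawSemiring semiring) using (sum)

  sumOver : ∀ {a} {A : Set a} → (A → Carrier) → List A → Carrier
  sumOver f xs = foldr _+_ 0# (map f xs)

  module _ {a} {A : Set a} where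

    sumOver-cong : {f g : A → Carrier} → (∀ z → f z ≈ g z) → ∀ xs → sumOver f xs ≈ sumOver g xs
    sumOver-cong f≈g []       = refl
    sumOver-cong f≈g (z ∷ xs) = +-cong (f≈g z) (sumOver-cong f≈g xs)

    sumOver-++ : ∀ (f : A → Carrier) xs ys → sumOver f (xs ++ ys) ≈ sumOver f xs + sumOver f ys
    sumOver-++ f []       ys = sym (+-identityˡ _)
    sumOver-++ f (z ∷ xs) ys = trans (+-congˡ (sumOver-++ f xs ys)) (sym (+-assoc _ _ _))

    sumOver-↭ : ∀ (f : A → Carrier) {xs ys} → xs ↭ ys → sumOver f xs ≈ sumOver f ys
    sumOver-↭ f Perm.refl          = refl
    sumOver-↭ f (Perm.prep z p)    = +-congˡ (sumOver-↭ f p)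
    sumOver-↭ f (Perm.swap z w p)  = trans (x∙yz≈y∙xz _ _ _) (+-congˡ (+-congˡ (sumOver-↭ f p)))
    sumOver-↭ f (Perm.trans p q)   = trans (sumOver-↭ f p) (sumOver-↭ f q)

    sumOver-*ˡ : ∀ b (f : A → Carrier) xs → sumOver (λ z → b * f z) xs ≈ b * sumOver f xs
    sumOver-*ˡ b f []       = sym (zeroʳ b)
    sumOver-*ˡ b f (z ∷ xs) = trans (+-congˡ (sumOver-*ˡ b f xs)) (sym (distribˡ _ _ _))

    sumOver-concat-tabulate : ∀ (f : A → Carrier) n (xss : Fin n → List A) →
                              sumOver f (concat (tabulate xss)) ≈ sum (λ i → sumOver f (xss i))
    sumOver-concat-tabulate f zero    xss = refl
    sumOver-concat-tabulate f (suc n) xss =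
      trans (sumOver-++ f (xss zero) _) (+-congˡ (sumOver-concat-tabulate f n (xss ∘ suc)))

  sumOver-map : ∀ {a b} {A : Set a} {B : Set b} (f : B → Carrier) (g : A → B) xs →
                sumOver f (map g xs) ≈ sumOver (λ z → f (g z)) xs
  sumOver-map f g xs = reflexive (≡.cong (foldr _+_ 0#) (≡.sym (map-∘ xs)))

  sumOver-cartesianProductWith :
    ∀ {a b d} {A : Set a} {B : Set b} {D : Set d} {f : D → Carrier} {g : A → Carrier} {h : B → Carrier}
    (_⊗_ : A → B → D) → (∀ u v → f (u ⊗ v) ≈ g u * h v) → ∀ xs ys →
    sumOver f (cartesianProductWith _⊗_ xs ys) ≈ sumOver g xs * sumOver h ys
  sumOver-cartesianProductWith _⊗_ f≈gh []       ys = sym (zeroˡ _)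
  sumOver-cartesianProductWith {f = f} {g} {h} _⊗_ f≈gh (u ∷ xs) ys = begin
    sumOver f (map (u ⊗_) ys ++ cartesianProductWith _⊗_ xs ys)
      ≈⟨ sumOver-++ f (map (u ⊗_) ys) _ ⟩
    sumOver f (map (u ⊗_) ys) + sumOver f (cartesianProductWith _⊗_ xs ys)
      ≈⟨ +-cong (sumOver-map f (u ⊗_) ys) (sumOver-cartesianProductWith _⊗_ f≈gh xs ys) ⟩
    sumOver (λ v → f (u ⊗ v)) ys + sumOver g xs * sumOver h ys
      ≈⟨ +-congʳ (trans (sumOver-cong (f≈gh u) ys) (sumOver-*ˡ (g u) h ys)) ⟩
    g u * sumOver h ys + sumOver g xs * sumOver h ys
      ≈⟨ distribʳ _ _ _ ⟨
    (g u + sumOver g xs) * sumOver h ys ∎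
    where open SetoidReasoning setoid

-- Elimination of `H` and completing the square

module QuadraticEquation {c ℓ} (R : CommutativeRing c ℓ) where
  open CommutativeRing R
  open RawSemiringDefinitions (Semiring.rawSemiring semiring) using (_^_) renaming (_×_ to _·_)
  open RingSolver commutativeSemiring
  open SetoidReasoning setoid

  -- After `H` is expanded once, it occurs only in `x ^ 2 * y * C` times `x * H + x * (x * H)`. The
  -- extra `x ^ 2 * y * C` on the left supplies the missing 1 that turns this factor back into `C`.
  quadratic : ∀ x y C H →
              C ≈ 1# + (x * H + x * (x * H)) →
              H ≈ C + x * (x * (C * (y * H))) →
              C + x ^ 2 * y * C ≈ 1# + (x + x ^ 2) * C + x ^ 2 * y * (C * C)
  quadratic x y C H C≈ H≈ = begin
    C + x ^ 2 * y * C
      ≈⟨ +-congʳ C≈ ⟩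
    1# + (x * H + x * (x * H)) + x ^ 2 * y * C
      ≈⟨ +-congʳ (+-congˡ (+-cong (*-congˡ H≈) (*-congˡ (*-congˡ H≈)))) ⟩
    1# + (x * (C + x * (x * (C * (y * H)))) + x * (x * (C + x * (x * (C * (y * H)))))) + x ^ 2 * y * C
      ≈⟨ solve 4 (λ x y C H →
           con 1 :+ (x :* (C :+ x :* (x :* (C :* (y :* H)))) :+ x :* (x :* (C :+ x :* (x :* (C :* (y :* H))))))
             :+ x :^ 2 :* y :* C
           := con 1 :+ (x :+ x :^ 2) :* C :+ x :^ 2 :* y :* (C :* (con 1 :+ (x :* H :+ x :* (x :* H)))))
           refl x y C H ⟩
    1# + (x + x ^ 2) * C + x ^ 2 * y * (C * (1# + (x * H + x * (x * H))))
      ≈⟨ +-congˡ (*-congˡ (*-congˡ C≈)) ⟨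
    1# + (x + x ^ 2) * C + x ^ 2 * y * (C * C) ∎

  -- The square of `q - p` in subtraction-free form, suited to a semiring solver.
  square-of-difference : ∀ {s p q} → s + p ≈ q → s * s + 2 · (p * q) ≈ q * q + p * p
  square-of-difference {s} {p} {q} s+p≈q = begin
    s * s + 2 · (p * q)             ≈⟨ +-congˡ (+-cong (*-congˡ s+p≈q) (+-congʳ (*-congˡ s+p≈q))) ⟨
    s * s + 2 · (p * (s + p))       ≈⟨ solve 2 (λ s p → s :* s :+ 2 :× (p :* (s :+ p))
                                           := (s :+ p) :* (s :+ p) :+ p :* p) refl s p ⟩
    (s + p) * (s + p) + p * p       ≈⟨ +-congʳ (*-cong s+p≈q s+p≈q) ⟩
    q * q + p * p                   ∎

  -- Completing the square: every subtraction is moved to the other side, so that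
  -- what remains is a multiple of the quadratic equation.
  discriminant : ∀ x y C →
    C + x ^ 2 * y * C ≈ 1# + (x + x ^ 2) * C + x ^ 2 * y * (C * C) →
    let S = 1# - x - x ^ 2 + x ^ 2 * y - 2 · x ^ 2 * y * C in
    S * S ≈ (1# - x - x ^ 2 * (1# + y)) ^ 2 - 4 · x ^ 3 * (1# + x) * y
  -- `S` is `q - p` and `U` is `1# - p′`. The summand added to both sides collects the cross terms
  -- of the two squares and the subtracted `V`.
  discriminant x y C eq = +-cancelʳ (2 · (p * q) + (2 · (p′ * 1#) + V)) _ _ (begin
    S * S + (2 · (p * q) + (2 · (p′ * 1#) + V))
      ≈⟨ +-assoc _ _ _ ⟨
    S * S + 2 · (p * q) + (2 · (p′ * 1#) + V)
      ≈⟨ +-congʳ (square-of-difference S+p≈q) ⟩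
    q * q + p * p + (2 · (p′ * 1#) + V)
      -- Since `p′` equals `σ + t` and `V` equals `4 · (σ * t)`, everything outside the `C`-free
      -- part `K` is `4 · t` times the right side of the quadratic equation.
      ≈⟨ solve 3 (λ x y C →
           let t = x :^ 2 :* y; σ = x :+ x :^ 2; p = σ :+ 2 :× (x :^ 2) :* y :* C; q = con 1 :+ t
               p′ = x :+ x :^ 2 :* (con 1 :+ y); V = 4 :× (x :^ 3) :* (con 1 :+ x) :* y in
           q :* q :+ p :* p :+ (2 :× (p′ :* con 1) :+ V)
           := con 1 :+ σ :* σ :+ 4 :× (σ :* t) :+ t :* t :+ 2 :× σ :+ 4 :× t :* (con 1 :+ σ :* C :+ t :* (C :* C)))
         refl x y C ⟩
    K + 4 · t * (1# + σ * C + t * (C * C))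
      ≈⟨ +-congˡ (*-congˡ eq) ⟨
    K + 4 · t * (C + t * C)
      ≈⟨ solve 3 (λ x y C →
           let t = x :^ 2 :* y; σ = x :+ x :^ 2; p = σ :+ 2 :× (x :^ 2) :* y :* C; q = con 1 :+ t
               p′ = x :+ x :^ 2 :* (con 1 :+ y) in
           con 1 :+ σ :* σ :+ 4 :× (σ :* t) :+ t :* t :+ 2 :× σ :+ 4 :× t :* (C :+ t :* C)
           := con 1 :* con 1 :+ p′ :* p′ :+ 2 :× (p :* q))
         refl x y C ⟩
    1# * 1# + p′ * p′ + 2 · (p * q)
      ≈⟨ +-congʳ (square-of-difference U+p′≈1) ⟨
    U * U + 2 · (p′ * 1#) + 2 · (p * q)
      ≈⟨ +-identityʳ _ ⟨
    U * U + 2 · (p′ * 1#) + 2 · (p * q) + 0#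
      ≈⟨ +-congˡ (-‿inverseˡ V) ⟨
    U * U + 2 · (p′ * 1#) + 2 · (p * q) + (- V + V)
      ≈⟨ solve 5 (λ U a b -V V → U :* U :+ a :+ b :+ (-V :+ V) := U :^ 2 :+ -V :+ (b :+ (a :+ V)))
           refl U (2 · (p′ * 1#)) (2 · (p * q)) (- V) V ⟩
    U ^ 2 - V + (2 · (p * q) + (2 · (p′ * 1#) + V)) ∎)
    where
    open AbelianGroupProperties +-abelianGroup using () renaming (∙-cancelʳ to +-cancelʳ)
    t σ p q p′ K S U V : Carrier
    t  = x ^ 2 * y
    σ  = x + x ^ 2
    p  = σ + 2 · x ^ 2 * y * C
    q  = 1# + t
    p′ = x + x ^ 2 * (1# + y)
    K  = 1# + σ * σ + 4 · (σ * t) + t * t + 2 · σ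
    S  = 1# - x - x ^ 2 + x ^ 2 * y - 2 · x ^ 2 * y * C
    U  = 1# - x - x ^ 2 * (1# + y)
    V  = 4 · x ^ 3 * (1# + x) * y

    S+p≈q : S + p ≈ q
    S+p≈q = begin
      S + p
        -- The solver treats negatives as independent atoms: it only pairs them with their
        -- positives, and the pairs cancel afterwards.
        ≈⟨ solve 7 (λ t a -a b -b d -d →
             con 1 :+ -a :+ -b :+ t :+ -d :+ (a :+ b :+ d) := con 1 :+ t :+ ((-a :+ a) :+ (-b :+ b) :+ (-d :+ d)))
             refl t x (- x) (x ^ 2) (- x ^ 2) (2 · x ^ 2 * y * C) (- (2 · x ^ 2 * y * C)) ⟩
      q + ((- x + x) + (- x ^ 2 + x ^ 2) + (- (2 · x ^ 2 * y * C) + 2 · x ^ 2 * y * C))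
        ≈⟨ +-congˡ (+-cong (+-cong (-‿inverseˡ _) (-‿inverseˡ _)) (-‿inverseˡ _)) ⟩
      q + (0# + 0# + 0#)
        ≈⟨ solve 1 (λ q → q :+ (con 0 :+ con 0 :+ con 0) := q) refl q ⟩
      q ∎

    U+p′≈1 : U + p′ ≈ 1#
    U+p′≈1 = begin
      U + p′
        ≈⟨ solve 4 (λ a -a b -b → con 1 :+ -a :+ -b :+ (a :+ b) := con 1 :+ ((-a :+ a) :+ (-b :+ b)))
             refl x (- x) (x ^ 2 * (1# + y)) (- (x ^ 2 * (1# + y))) ⟩
      1# + ((- x + x) + (- (x ^ 2 * (1# + y)) + x ^ 2 * (1# + y)))
        ≈⟨ +-congˡ (+-cong (-‿inverseˡ _) (-‿inverseˡ _)) ⟩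
      1# + (0# + 0#)
        ≈⟨ solve 0 (con 1 :+ (con 0 :+ con 0) := con 1) refl ⟩
      1# ∎

  subtract-difference : ∀ w p → p ≈ w - (w - p)
  subtract-difference w p = sym (begin
    w - (w - p)       ≈⟨ +-congˡ (⁻¹-∙-comm w (- p)) ⟨
    w + (- w - - p)   ≈⟨ +-assoc _ _ _ ⟨
    w - w - - p       ≈⟨ +-cong (-‿inverseʳ w) (⁻¹-involutive p) ⟩
    0# + p            ≈⟨ +-identityˡ p ⟩
    p                 ∎)
    where open AbelianGroupProperties +-abelianGroup using (⁻¹-∙-comm; ⁻¹-involutive)

-- Functional equations for the generating functions

module GeneratingFunctions {c ℓ} (R : CommutativeRing c ℓ) (Y : CommutativeRing.Carrier R) where
  open CommutativeRing R hiding (zero)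
  open PowerSeriesRing R using (const-⊛) renaming (commutativeRing to seriesRing)
  open PowerSeries rawRing using (Series; const) renaming (var to X)
  open ListSum R
  open AvoidingWords
  open Exp semiring using (_^_; ^-homo-*)
  open MonoidSum +-monoid using (sum; sum-cong-≋)
  open SetoidReasoning setoid
  private module S = CommutativeRing seriesRing

  X-*-zero : ∀ f → (X S.* f) 0 ≈ 0#
  X-*-zero f = trans (+-identityʳ _) (zeroˡ _)

  X-*-suc : ∀ f n → (X S.* f) (suc n) ≈ f n
  X-*-suc f n = trans (+-cong (zeroˡ _) (trans (S.*-congʳ {f} {λ n → X (suc n)} {S.1#} X-suc n) (S.*-identityˡ f n)))
                      (+-identityˡ _)
    where
    X-suc : ∀ n → X (suc n) ≈ S.1# n
    X-suc zero    = refl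
    X-suc (suc n) = refl

  weight : Word → Carrier
  weight w = Y ^ des w

  -- Tails are weighted together with the omitted leading 0, as in `des-first-return`.
  weight-0∷ : Word → Carrier
  weight-0∷ v = weight (0 ∷ v)

  C≥≥ : Series
  C≥≥ n = sumOver weight (words n)

  H : Series
  H n = sumOver weight-0∷ (tails n)

  C-equation : C≥≥ S.≈ S.1# S.+ (X S.* H S.+ X S.* (X S.* H))
  -- Only the empty word has length 0, and its weight is `1#`.
  C-equation zero    = +-congˡ (sym (trans (+-cong (X-*-zero H) (X-*-zero (X S.* H))) (+-identityʳ 0#)))
  C-equation (suc n) = begin
    C≥≥ (suc n)
      ≈⟨ sumOver-↭ weight (words-↭ n) ⟩
    sumOver weight (map (0 ∷_) (tails n) ++ doubled n)
      ≈⟨ sumOver-++ weight (map (0 ∷_) (tails n)) (doubled n) ⟩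
    sumOver weight (map (0 ∷_) (tails n)) + sumOver weight (doubled n)
      ≈⟨ +-cong (trans (sumOver-map weight (0 ∷_) (tails n)) (sym (X-*-suc H n)))
                (trans (doubled-sum n) (sym (X-*-suc (X S.* H) n))) ⟩
    (X S.* H S.+ X S.* (X S.* H)) (suc n)
      ≈⟨ +-identityˡ _ ⟨
    (S.1# S.+ (X S.* H S.+ X S.* (X S.* H))) (suc n) ∎
    where
    doubled-sum : ∀ n → sumOver weight (doubled n) ≈ (X S.* H) n
    doubled-sum zero    = sym (X-*-zero H)
    -- The step from 0 to 0 is no descent, so `weight (0 ∷ 0 ∷ v)` computes to `weight-0∷ v`.
    doubled-sum (suc n) = trans (sumOver-map weight (λ v → 0 ∷ 0 ∷ v) (tails n)) (sym (X-*-suc H n))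

  H-equation : H S.≈ C≥≥ S.+ X S.* (X S.* (C≥≥ S.* (const Y S.* H)))
  H-equation n = begin
    H n
      ≈⟨ sumOver-↭ weight-0∷ (tails-↭ n) ⟩
    sumOver weight-0∷ (map (map suc) (words n) ++ returning n)
      ≈⟨ sumOver-++ weight-0∷ (map (map suc) (words n)) (returning n) ⟩
    sumOver weight-0∷ (map (map suc) (words n)) + sumOver weight-0∷ (returning n)
      ≈⟨ +-cong lifted-sum (returning-sum n) ⟩
    (C≥≥ S.+ X S.* (X S.* (C≥≥ S.* (const Y S.* H)))) n ∎
    where
    CyH : Series
    CyH = C≥≥ S.* (const Y S.* H)

    lifted-sum : sumOver weight-0∷ (map (map suc) (words n)) ≈ C≥≥ n
    lifted-sum = trans (sumOver-map weight-0∷ (map suc) (words n))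
      (sumOver-cong (λ u → reflexive (≡.cong (Y ^_) (des-0∷map-suc u))) (words n))

    -- The extra factor `Y` marks the descent into the first later 0.
    weight-first-return : ∀ u v → weight-0∷ (first-return u v) ≈ weight u * (Y * weight-0∷ v)
    weight-first-return u v =
      trans (reflexive (≡.cong (Y ^_) (des-first-return u v))) (^-homo-* Y (des u) (suc (des (0 ∷ v))))

    returnsAt-sum : ∀ n i → sumOver weight-0∷ (returnsAt n i) ≈ C≥≥ (toℕ i) * (const Y S.* H) (n ∸ toℕ i)
    returnsAt-sum n i = trans
      (sumOver-cartesianProductWith first-return weight-first-return (words (toℕ i)) (tails (n ∸ toℕ i)))
      (*-congˡ (trans (sumOver-*ˡ Y weight-0∷ (tails (n ∸ toℕ i))) (sym (const-⊛ Y H (n ∸ toℕ i)))))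

    returning-sum : ∀ n → sumOver weight-0∷ (returning n) ≈ (X S.* (X S.* CyH)) n
    returning-sum zero          = sym (X-*-zero (X S.* CyH))
    returning-sum (suc zero)    = sym (trans (X-*-suc (X S.* CyH) 0) (X-*-zero CyH))
    returning-sum (suc (suc n)) = begin
      sumOver weight-0∷ (concat (tabulate (returnsAt n)))
        ≈⟨ sumOver-concat-tabulate weight-0∷ (suc n) (returnsAt n) ⟩
      sum (λ i → sumOver weight-0∷ (returnsAt n i))
        ≈⟨ sum-cong-≋ (returnsAt-sum n) ⟩
      CyH n
        ≈⟨ X-*-suc CyH n ⟨
      (X S.* CyH) (suc n)
        ≈⟨ X-*-suc (X S.* CyH) (suc n) ⟨
      (X S.* (X S.* CyH)) (suc (suc n)) ∎

-- Specialisation to integer polynomials in `y` and the closed form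

open import Defs

ℤ[y]-commutativeRing : CommutativeRing 0ℓ 0ℓ
ℤ[y]-commutativeRing = PolynomialRing.commutativeRing ℤ.+-*-commutativeRing

open GeneratingFunctions ℤ[y]-commutativeRing (Polynomial.var ℤ.+-*-rawRing)
open QuadraticEquation (PowerSeriesRing.commutativeRing ℤ[y]-commutativeRing)

theorem3p13 : ∃[ S ] (S IsSqrtOf ((1# - x - x ^ 2 * (1# + y)) ^ 2 - 4 · x ^ 3 * (1# + x) * y))
    × ((2 · x ^ 2 * y) * C _≥?_ _≥?_ ≈ 1# - x - x ^ 2 + x ^ 2 * y - S)
theorem3p13 =
  -- The root is obtained by solving the claimed identity for it, so the content lies in `square`.
  -- Here `C≥≥` is by definition `C _≥?_ _≥?_`.
  1# - x - x ^ 2 + x ^ 2 * y - 2 · x ^ 2 * y * C≥≥ ,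
  record
    { square       = discriminant x y C≥≥ (quadratic x y C≥≥ H C-equation H-equation)
    -- At index 0 every summand except `1#` evaluates to the empty coefficient list.
    ; constantTerm = λ k → ≡.refl
    } ,
  subtract-difference (1# - x - x ^ 2 + x ^ 2 * y) (2 · x ^ 2 * y * C≥≥)
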